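{- For any plane tree $T$ (with $n\ge 1$ edges) and any node $v$ of $T$, $$(\mathsf{lev},\mathsf{lsw},\mathsf{rsw})_{T}(v)=(\mathsf{dlev},\mathsf{dlsw},\mathsf{drsw})_{\tilde\phi(T)}(v).$$
   Context: **Plane trees.** A plane tree is a rooted tree in which the children of each node are linearly ordered (left to right). $\mathcal{P}_n$ is the set of plane trees with $n\ge1$ edges. The nodes of $T\in\mathcal P_n$ are named $0,1,\dots,n$ (only to distinguish them), the root being $0$ and the leftmost child of the root being $1$. Nodes with the same parent are siblings; siblings to the left of a node are elder, those to the right are younger; the eldest child of a node is its leftmost child. **Binary trees and the involution $\tilde\phi$.** A binary tree is a rooted tree in which each node has at most one left child and at most one right child; $\mathcal{B}_n$ is the set of binary trees with $n$ nodes. The bijection $\varphi:\mathcal P_n\to\mathcal B_n$: the nodes of $\varphi(T)$ are the non-root nodes of $T$; its root is the leftmost child of the root of $T$; for non-root nodes $x,y$ of $T$, $y$ is the left child of $x$ in $\varphi(T)$ iff $y$ is the leftmost child of $x$ in $T$, and $y$ is the right child of $x$ in $\varphi(T)$ iff $x$ is the closest elder sibling of $y$ in $T$. For $B\in\mathcal B_n$, $\phi(B)$ is the mirror image of $B$ (same nodes, left and right children exchanged). Put $\tilde\phi=\varphi^{ -1}\circ\phi\circ\varphi:\mathcal P_n\to\mathcal P_n$. Node names are kept, so $T$ and $\tilde\phi(T)$ have the same node set, both with root $0$. **Statistics of a node $v$ of a plane tree $T$.** - $\mathsf{lev}_T(v)$: number of edges on the path from $v$ to the root. - $\mathsf{Lc}_T(v)$: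 the set of nodes attached to nodes other than $v$ on the path from $v$ to the root from the left-hand side, i.e. the set of all elder siblings of the non-root nodes on this path ($v$ included); $\mathsf{lc}_T(v)=|\mathsf{Lc}_T(v)|$. - $\mathsf{lsw}_T(v)$: the number of children of $v$ plus $\mathsf{lc}_T(v)$. - $\mathsf{rsw}_T(v)$: the number of children of $v$ plus the number of edges attached to nodes other than $v$ on the path from $v$ to the root from the right-hand side (i.e. plus the total number of younger siblings of the non-root nodes on this path, $v$ included). - $\mathsf{lchain}_T(v)$: the length (number of edges) of the left chain of $v$, i.e. the path $v=v_1,v_2,\dots,v_k$ where $v_{i+1}$ is the eldest child of $v_i$ and $v_k$ is a leaf. - $\mathsf{dlev}_T(v)=0$ if $v$ is the root, and $\mathsf{dlev}_T(v)=\mathsf{lc}_T(v)+1$ otherwise. - $\mathsf{dlsw}_T(v)=\mathsf{lchain}_T(v)$ if $v$ is the root; $\mathsf{dlsw}_T(v)=\mathsf{lchain}_T(u)+\mathsf{lev}_T(v)$ if $v$ has a closest younger sibling $u$; and $\mathsf{dlsw}_T(v)=\mathsf{lev}_T(v)-1$ otherwise. - $\mathsf{drsw}_T(v)=1+\sum_{w\in\mathsf{Lc}_T(v)\cup\{u,v\}}\mathsf{lchain}_T(w)$ if $v$ has a closest younger sibling $u$; and $\mathsf{drsw}_T(v)=\sum_{w\in\mathsf{Lc}_T(v)\cup\{v\}}\mathsf{lchain}_T(w)$ otherwise. The displayed equality means equality of the three components in order. -}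

module Defs where

open import Data.Bool.Base using (Bool; true; false; if_then_else_)
open import Data.Fin.Base using (Fin; zero; suc; toℕ)
open import Data.List.Base
  using (List; []; _∷_; _++_; length; lookup; map; head; allFin; tabulate)
open import Data.List.Membership.Propositional using (_∈_)
open import Data.List.Membership.Propositional.Properties using (∈-++⁻; ∈-allFin)
open import Data.List.Relation.Binary.Permutation.Propositional
  using (_↭_; ↭-refl; ↭-sym; ↭-trans; prep)
open import Data.List.Relation.Binary.Permutation.Propositional.Properties
  using (drop-∷; ++-comm; ++⁺; ∈-resp-↭)
open import Data.List.Relation.Unary.Any using (here; there)
import Data.Maybe.Base as Maybe
open import Data.Maybe.Base using (Maybe; just; nothing; maybe)
open import Data.Nat.Base using (ℕ; zero; suc; _+_; _∸_)
open import Data.Nat.ListAction using (sum)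
open import Data.Product.Base using (∃; _,_; proj₁; proj₂)
open import Data.Sum.Base using (inj₁; inj₂)
open import Function.Base using (_∘_)
open import Relation.Binary.PropositionalEquality
  using (_≡_; refl; sym; trans; cong; cong₂; subst)

private
  variable
    A : Set
    n : ℕ

------------------------------------------------------------------------
-- Plane trees

-- A plane tree whose nodes carry names in A; children are listed from
-- left (eldest) to right (youngest).
data Tree (A : Set) : Set where
  node : A → List (Tree A) → Tree A

rootName : Tree A → A
rootName (node a _) = a

children : Tree A → List (Tree A)
children (node _ ts) = ts

names  : Tree A → List A
namesF : List (Tree A) → List A
names (node a ts) = a ∷ namesF ts
namesF []         = []
namesF (t ∷ ts)   = names t ++ namesF ts

-- The n + 1 nodes bear the names 0, …, n, each exactly once, with the
-- root named 0 and its leftmost child named 1.  The last condition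
-- forces n ≥ 1.
record 𝒫 (n : ℕ) : Set where
  constructor mk𝒫
  field
    tree     : Tree (Fin (suc n))
    root≡0   : rootName tree ≡ zero
    eldest≡1 : Maybe.map (toℕ ∘ rootName) (head (children tree)) ≡ just 1
    named    : names tree ↭ allFin (suc n)

------------------------------------------------------------------------
-- Binary trees

data Bin (A : Set) : Set where
  empty : Bin A
  bin   : (name : A) (left right : Bin A) → Bin A

rootNameᴮ : Bin A → Maybe A
rootNameᴮ empty       = nothing
rootNameᴮ (bin a _ _) = just a

namesᴮ : Bin A → List A
namesᴮ empty       = []
namesᴮ (bin a l r) = a ∷ namesᴮ l ++ namesᴮ r

-- The n nodes bear the names 1, …, n, each exactly once, with the root
-- named 1.
record ℬ (n : ℕ) : Set where
  constructor mkℬ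
  field
    tree   : Bin (Fin (suc n))
    root≡1 : Maybe.map toℕ (rootNameᴮ tree) ≡ just 1
    named  : namesᴮ tree ↭ tabulate {n = n} suc

------------------------------------------------------------------------
-- The bijection φ, on the list of siblings hanging below a node: the
-- leftmost child becomes the left child, the next younger sibling
-- becomes the right child.

φᶠ : List (Tree A) → Bin A
φᶠ []               = empty
φᶠ (node a cs ∷ ts) = bin a (φᶠ cs) (φᶠ ts)

φᶠ⁻¹ : Bin A → List (Tree A)
φᶠ⁻¹ empty       = []
φᶠ⁻¹ (bin a l r) = node a (φᶠ⁻¹ l) ∷ φᶠ⁻¹ r

φᶠ⁻¹-φᶠ : (ts : List (Tree A)) → φᶠ⁻¹ (φᶠ ts) ≡ ts
φᶠ⁻¹-φᶠ []               = refl
φᶠ⁻¹-φᶠ (node a cs ∷ ts) = cong₂ (λ l r → node a l ∷ r) (φᶠ⁻¹-φᶠ cs) (φᶠ⁻¹-φᶠ ts)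

φᶠ-φᶠ⁻¹ : (b : Bin A) → φᶠ (φᶠ⁻¹ b) ≡ b
φᶠ-φᶠ⁻¹ empty       = refl
φᶠ-φᶠ⁻¹ (bin a l r) = cong₂ (bin a) (φᶠ-φᶠ⁻¹ l) (φᶠ-φᶠ⁻¹ r)

mirror : Bin A → Bin A
mirror empty       = empty
mirror (bin a l r) = bin a (mirror r) (mirror l)

namesᴮ-φᶠ : (ts : List (Tree A)) → namesᴮ (φᶠ ts) ≡ namesF ts
namesᴮ-φᶠ []               = refl
namesᴮ-φᶠ (node a cs ∷ ts) =
  cong (a ∷_) (cong₂ _++_ (namesᴮ-φᶠ cs) (namesᴮ-φᶠ ts))

namesF-φᶠ⁻¹ : (b : Bin A) → namesF (φᶠ⁻¹ b) ≡ namesᴮ b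
namesF-φᶠ⁻¹ b = trans (sym (namesᴮ-φᶠ (φᶠ⁻¹ b))) (cong namesᴮ (φᶠ-φᶠ⁻¹ b))

namesᴮ-mirror : (b : Bin A) → namesᴮ (mirror b) ↭ namesᴮ b
namesᴮ-mirror empty       = ↭-refl
namesᴮ-mirror (bin a l r) =
  prep a (↭-trans (++⁺ (namesᴮ-mirror r) (namesᴮ-mirror l))
                  (++-comm (namesᴮ r) (namesᴮ l)))

φ : 𝒫 n → ℬ n
φ (mk𝒫 (node _ ts) refl e p) =
  mkℬ (φᶠ ts) (eldest ts e)
      (subst (_↭ tabulate suc) (sym (namesᴮ-φᶠ ts)) (drop-∷ p))
  where
  eldest : ∀ ts → Maybe.map (toℕ ∘ rootName) (head ts) ≡ just 1 →
           Maybe.map toℕ (rootNameᴮ (φᶠ ts)) ≡ just 1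
  eldest (node _ _ ∷ _) e = e

φ⁻¹ : ℬ n → 𝒫 n
φ⁻¹ (mkℬ b e p) =
  mk𝒫 (node zero (φᶠ⁻¹ b)) refl (eldest b e)
      (prep zero (subst (_↭ tabulate suc) (sym (namesF-φᶠ⁻¹ b)) p))
  where
  eldest : ∀ b → Maybe.map toℕ (rootNameᴮ b) ≡ just 1 →
           Maybe.map (toℕ ∘ rootName) (head (φᶠ⁻¹ b)) ≡ just 1
  eldest (bin _ _ _) e = e

φ⁻¹-φ : (T : 𝒫 n) → 𝒫.tree (φ⁻¹ (φ T)) ≡ 𝒫.tree T
φ⁻¹-φ (mk𝒫 (node _ ts) refl _ _) = cong (node zero) (φᶠ⁻¹-φᶠ ts)

φ-φ⁻¹ : (B : ℬ n) → ℬ.tree (φ (φ⁻¹ B)) ≡ ℬ.tree B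
φ-φ⁻¹ (mkℬ b _ _) = φᶠ-φᶠ⁻¹ b

mirrorℬ : ℬ n → ℬ n
mirrorℬ (mkℬ b e p) = mkℬ (mirror b) (root b e) (↭-trans (namesᴮ-mirror b) p)
  where
  root : ∀ b → Maybe.map toℕ (rootNameᴮ b) ≡ just 1 →
         Maybe.map toℕ (rootNameᴮ (mirror b)) ≡ just 1
  root (bin _ _ _) e = e

φ~ : 𝒫 n → 𝒫 n
φ~ = φ⁻¹ ∘ mirrorℬ ∘ φ

------------------------------------------------------------------------
-- Nodes of a tree

-- A node is the path leading down to it from the root; `child i v` is
-- the node v of the i-th subtree of the root.
data Node {A : Set} : Tree A → Set where
  root  : ∀ {t} → Node t
  child : ∀ {a ts} (i : Fin (length ts)) → Node (lookup ts i) → Node (node a ts)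

subtree : {t : Tree A} → Node t → Tree A
subtree {t = t} root = t
subtree (child _ v)  = subtree v

name : {t : Tree A} → Node t → A
name v = rootName (subtree v)

locate  : ∀ {a} (t : Tree A) → a ∈ names t → ∃ λ (v : Node t) → name v ≡ a
locateF : ∀ {a} (ts : List (Tree A)) → a ∈ namesF ts →
          ∃ λ i → ∃ λ (v : Node (lookup ts i)) → name v ≡ a
locate (node _ ts) (here a≡)  = root , sym a≡
locate (node _ ts) (there a∈) =
  let i , v , eq = locateF ts a∈ in child i v , eq
locateF (t ∷ ts) a∈ with ∈-++⁻ (names t) a∈
... | inj₁ a∈t  = let v , eq = locate t a∈t in zero , v , eq
... | inj₂ a∈ts = let i , v , eq = locateF ts a∈ts in suc i , v , eq

private
  located : (T : 𝒫 n) (v : Fin (suc n)) →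
            ∃ λ (x : Node (𝒫.tree T)) → name x ≡ v
  located T v =
    locate (𝒫.tree T) (∈-resp-↭ (↭-sym (𝒫.named T)) (∈-allFin v))

-- T at v is the node of T named v.
infix 8 _at_
_at_ : (T : 𝒫 n) → Fin (suc n) → Node (𝒫.tree T)
T at v = proj₁ (located T v)

name-at : (T : 𝒫 n) (v : Fin (suc n)) → name (T at v) ≡ v
name-at T v = proj₂ (located T v)

------------------------------------------------------------------------
-- Siblings

-- The indices smaller, respectively larger, than the given one, in
-- increasing order.
below above : Fin n → List (Fin n)
below zero    = []
below (suc i) = zero ∷ map suc (below i)
above {suc n} zero    = map suc (allFin n)
above {suc n} (suc i) = map suc (above i)

isRoot : {t : Tree A} → Node t → Bool
isRoot root        = true
isRoot (child _ _) = false

closestYounger : {t : Tree A} → Node t → Maybe (Node t)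
closestYounger root        = nothing
closestYounger (child i v) =
  if isRoot v then Maybe.map (λ j → child j root) (head (above i))
              else Maybe.map (child i) (closestYounger v)

-- All elder (Lc), respectively younger (Rc), siblings of the non-root
-- nodes on the path from the given node to the root.
Lc Rc : {t : Tree A} → Node t → List (Node t)
Lc root        = []
Lc (child i v) = map (λ j → child j root) (below i) ++ map (child i) (Lc v)
Rc root        = []
Rc (child i v) = map (λ j → child j root) (above i) ++ map (child i) (Rc v)

------------------------------------------------------------------------
-- Statistics

degree lc lev lsw rsw : {t : Tree A} → Node t → ℕ
degree v = length (children (subtree v))

lc v = length (Lc v)

lev root        = 0
lev (child _ v) = suc (lev v)

lsw v = degree v + lc v

rsw v = degree v + length (Rc v)

leftChain : Tree A → ℕ
leftChain (node _ [])      = 0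
leftChain (node _ (t ∷ _)) = suc (leftChain t)

lchain dlev dlsw drsw : {t : Tree A} → Node t → ℕ
lchain v = leftChain (subtree v)

dlev root          = 0
dlev v@(child _ _) = lc v + 1

-- In the default case v is not the root, so lev v ≥ 1 and the
-- subtraction is exact.
dlsw v@root        = lchain v
dlsw v@(child _ _) = maybe (λ u → lchain u + lev v) (lev v ∸ 1) (closestYounger v)

-- Lc v contains neither v nor a younger sibling of v, and has no
-- repetitions, so the lists below enumerate the unions Lc v ∪ {u , v}
-- and Lc v ∪ {v}.
drsw v = maybe (λ u → 1 + sum (map lchain (Lc v ++ u ∷ v ∷ [])))
               (sum (map lchain (Lc v ++ v ∷ [])))
               (closestYounger v)

{-# OPTIONS --safe #-}

-- A non-root node of a plane tree is a position in the associated binary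
-- tree.  Its level is one more than the number of left steps leading to the
-- position, lc is the number of right steps, degrees are lengths of right
-- spines and lengths of left chains are lengths of left spines.  Mirroring
-- swaps left and right in each of these quantities.

module Submission where

open import Defs
open import Data.Bool.Base using (true; false)
open import Data.Fin.Base using (Fin; zero; suc)
open import Data.List.Base
  using (List; []; _∷_; _++_; length; lookup; map; head; allFin)
open import Data.List.Membership.Propositional using (_∈_)
open import Data.List.Membership.Propositional.Properties using (∈-++⁺ˡ; ∈-++⁺ʳ)
open import Data.List.Properties
  using (length-++; length-map; length-tabulate; map-++; map-∘)
open import Data.List.Relation.Binary.Disjoint.Propositional using (Disjoint)
open import Data.List.Relation.Binary.Permutation.Propositional
  using (_↭_; ↭-sym; ↭⇒↭ₛ)
import Data.List.Relation.Binary.Permutation.Setoid.Properties as PermutationSetoid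
open import Data.List.Relation.Unary.All as All using ()
open import Data.List.Relation.Unary.All.Properties using (++⁻ˡ; ++⁻ʳ)
open import Data.List.Relation.Unary.AllPairs using ([]; _∷_; tail)
open import Data.List.Relation.Unary.Any using (here; there)
open import Data.List.Relation.Unary.Unique.Propositional using (Unique)
open import Data.List.Relation.Unary.Unique.Propositional.Properties
  using (allFin⁺; Unique[x∷xs]⇒x∉xs)
import Data.Maybe.Base as Maybe
open import Data.Maybe.Base using (just; nothing; maybe)
import Data.Maybe.Properties as Maybeₚ
open import Data.Nat.Base using (ℕ; suc; _+_; _∸_; _≥_)
open import Data.Nat.ListAction using (sum)
open import Data.Nat.ListAction.Properties using (sum-++)
open import Data.Nat.Properties using (+-comm; +-assoc; +-identityʳ; +-suc)
open import Data.Nat.Solver using (module +-*-Solver)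
open import Data.Product.Base using (∃; _×_; _,_; proj₁; proj₂)
open import Function.Base using (_∘_)
open import Relation.Binary.PropositionalEquality
  using (_≡_; _≢_; refl; sym; trans; cong; cong₂; subst; module ≡-Reasoning)
open import Relation.Binary.PropositionalEquality.Properties using (setoid)
open import Relation.Nullary.Negation using (contradiction)

open ≡-Reasoning

private
  variable
    A : Set
    a a′ : A
    b l r : Bin A
    t : Tree A
    ts : List (Tree A)
    n : ℕ

-- Lists without repetitions

Unique-resp-↭ : {xs ys : List A} → xs ↭ ys → Unique xs → Unique ys
Unique-resp-↭ p = PermutationSetoid.Unique-resp-↭ (setoid _) (↭⇒↭ₛ p)

Unique-++⁻ : (xs : List A) {ys : List A} → Unique (xs ++ ys) →
             Unique xs × Unique ys × Disjoint xs ys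
Unique-++⁻ []       u        = [] , u , λ ()
Unique-++⁻ (x ∷ xs) (x∉ ∷ u) =
  let ux , uy , d = Unique-++⁻ xs u in
  ++⁻ˡ xs x∉ ∷ ux , uy ,
  λ { (here refl , y∈) → All.lookup (++⁻ʳ xs x∉) y∈ refl
    ; (there x∈ , y∈)  → d (x∈ , y∈) }

-- Positions in a binary tree

data Pos {A : Set} : Bin A → Set where
  here  : ∀ {a l r} → Pos (bin a l r)
  left  : ∀ {a l r} → Pos l → Pos (bin a l r)
  right : ∀ {a l r} → Pos r → Pos (bin a l r)

mirrorPos : Pos b → Pos (mirror b)
mirrorPos here      = here
mirrorPos (left p)  = right (mirrorPos p)
mirrorPos (right p) = left (mirrorPos p)

posName : {b : Bin A} → Pos b → A
posName (here {a = a}) = a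
posName (left p)       = posName p
posName (right p)      = posName p

leftOf rightOf : {b : Bin A} → Pos b → Bin A
leftOf (here {l = l})  = l
leftOf (left p)        = leftOf p
leftOf (right p)       = leftOf p
rightOf (here {r = r}) = r
rightOf (left p)       = rightOf p
rightOf (right p)      = rightOf p

rightOf-mirror : (p : Pos b) → rightOf (mirrorPos p) ≡ mirror (leftOf p)
rightOf-mirror here      = refl
rightOf-mirror (left p)  = rightOf-mirror p
rightOf-mirror (right p) = rightOf-mirror p

posName-mirror : (p : Pos b) → posName (mirrorPos p) ≡ posName p
posName-mirror here      = refl
posName-mirror (left p)  = posName-mirror p
posName-mirror (right p) = posName-mirror p

lefts rights : Pos b → ℕ
lefts here       = 0
lefts (left p)   = suc (lefts p)
lefts (right p)  = lefts p
rights here      = 0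
rights (left p)  = rights p
rights (right p) = suc (rights p)

rights-mirror : (p : Pos b) → rights (mirrorPos p) ≡ lefts p
rights-mirror here      = refl
rights-mirror (left p)  = cong suc (rights-mirror p)
rights-mirror (right p) = rights-mirror p

lefts-mirror : (p : Pos b) → lefts (mirrorPos p) ≡ rights p
lefts-mirror here      = refl
lefts-mirror (left p)  = lefts-mirror p
lefts-mirror (right p) = cong suc (lefts-mirror p)

posName∈ : (p : Pos b) → posName p ∈ namesᴮ b
posName∈ here                = here refl
posName∈ (left p)            = there (∈-++⁺ˡ (posName∈ p))
posName∈ (right {l = l} p)   = there (∈-++⁺ʳ (namesᴮ l) (posName∈ p))

-- Nodes of the two trees are matched only by name. Distinct names allow an equality of names to be
-- turned into an equality of positions.
posName-injective : (b : Bin A) → Unique (namesᴮ b) → (p q : Pos b) →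
                    posName p ≡ posName q → p ≡ q
posName-injective (bin a l r) u@(_ ∷ u′) = inj
  where
  uniques = Unique-++⁻ (namesᴮ l) u′

  a≢left : (p : Pos l) → a ≡ posName p → ∀ {B : Set} → B
  a≢left p refl = contradiction (∈-++⁺ˡ (posName∈ p)) (Unique[x∷xs]⇒x∉xs u)

  a≢right : (p : Pos r) → a ≡ posName p → ∀ {B : Set} → B
  a≢right p refl =
    contradiction (∈-++⁺ʳ (namesᴮ l) (posName∈ p)) (Unique[x∷xs]⇒x∉xs u)

  left≢right : (p : Pos l) (q : Pos r) → posName p ≡ posName q → ∀ {B : Set} → B
  left≢right p q eq = contradiction
    (subst (_∈ namesᴮ l) eq (posName∈ p) , posName∈ q) (proj₂ (proj₂ uniques))

  inj : (p q : Pos (bin a l r)) → posName p ≡ posName q → p ≡ q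
  inj here      here      eq = refl
  inj here      (left q)  eq = a≢left q eq
  inj here      (right q) eq = a≢right q eq
  inj (left p)  here      eq = a≢left p (sym eq)
  inj (left p)  (left q)  eq =
    cong left (posName-injective l (proj₁ uniques) p q eq)
  inj (left p)  (right q) eq = left≢right p q eq
  inj (right p) here      eq = a≢right p (sym eq)
  inj (right p) (left q)  eq = left≢right q p (sym eq)
  inj (right p) (right q) eq =
    cong right (posName-injective r (proj₁ (proj₂ uniques)) p q eq)

-- Positions as nodes of the plane tree

-- `index` and `inner` split a position as `child` requires: the sibling whose subtree contains it,
-- then the node inside that subtree. Right steps before the first left step move along the
-- siblings; that left step enters the subtree.
index : (p : Pos b) → Fin (length (φᶠ⁻¹ b))
index here      = zero
index (left p)  = zero
index (right p) = suc (index p)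

inner : (p : Pos b) → Node (lookup (φᶠ⁻¹ b) (index p))
inner here      = root
inner (left p)  = child (index p) (inner p)
inner (right p) = inner p

-- The root name `a` is left free because a left step restarts the construction below another root:
-- `inner (left p)` is `toNode p`, with the node just passed as root.
toNode : (p : Pos b) → Node (node a (φᶠ⁻¹ b))
toNode p = child (index p) (inner p)

-- The equation is between dependent pairs, as the type of `v` depends on `i`; matching it with
-- `refl` replaces both at once.
inner-surjective : (b : Bin A) (i : Fin (length (φᶠ⁻¹ b)))
                   (v : Node (lookup (φᶠ⁻¹ b) i)) →
                   ∃ λ (p : Pos b) → _≡_ {A = ∃ (Node ∘ lookup (φᶠ⁻¹ b))}
                                         (index p , inner p) (i , v)
inner-surjective (bin a l r) zero root = here , refl
inner-surjective (bin a l r) zero (child i v) with inner-surjective l i v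
... | p , refl = left p , refl
inner-surjective (bin a l r) (suc i) v with inner-surjective r i v
... | p , refl = right p , refl

-- The root of the plane tree has no counterpart in the binary tree, hence a case of its own.
data View {a : A} {b : Bin A} : Node (node a (φᶠ⁻¹ b)) → Set where
  atRoot : View root
  atPos  : (p : Pos b) → View (toNode p)

view : {b : Bin A} (v : Node (node a (φᶠ⁻¹ b))) → View v
view root = atRoot
view {b = b} (child i v) with inner-surjective b i v
... | p , refl = atPos p

subtree-inner : (p : Pos b) → subtree (inner p) ≡ node (posName p) (φᶠ⁻¹ (leftOf p))
subtree-inner here      = refl
subtree-inner (left p)  = subtree-inner p
subtree-inner (right p) = subtree-inner p

name-toNode : (p : Pos b) → name (toNode {a = a} p) ≡ posName p
name-toNode p = cong rootName (subtree-inner p)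

-- Statistics of a node in terms of its position

length-above-zero : ∀ n → length (above {suc n} zero) ≡ n
length-above-zero n =
  trans (length-map suc (allFin n)) (length-tabulate (λ i → i))

length-above-suc : (i : Fin n) → length (above (suc i)) ≡ length (above i)
length-above-suc i = length-map suc (above i)

length-Lc-child : (ts : List (Tree A)) (i : Fin (length ts)) (v : Node (lookup ts i)) →
                  lc (child {a = a} {ts} i v) ≡ length (below i) + lc v
length-Lc-child {a = a} ts i v = begin
  length (map elder (below i) ++ map (child {a = a} {ts} i) (Lc v))
    ≡⟨ length-++ (map elder (below i)) ⟩
  length (map elder (below i)) + length (map (child {a = a} {ts} i) (Lc v))
    ≡⟨ cong₂ _+_ (length-map elder (below i)) (length-map (child {a = a} {ts} i) (Lc v)) ⟩
  length (below i) + lc v ∎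
  where
  elder : Fin (length ts) → Node (node a ts)
  elder j = child j root

length-Rc-child : (ts : List (Tree A)) (i : Fin (length ts)) (v : Node (lookup ts i)) →
                  length (Rc (child {a = a} {ts} i v)) ≡ length (above i) + length (Rc v)
length-Rc-child {a = a} ts i v = begin
  length (map younger (above i) ++ map (child {a = a} {ts} i) (Rc v))
    ≡⟨ length-++ (map younger (above i)) ⟩
  length (map younger (above i)) + length (map (child {a = a} {ts} i) (Rc v))
    ≡⟨ cong₂ _+_ (length-map younger (above i)) (length-map (child {a = a} {ts} i) (Rc v)) ⟩
  length (above i) + length (Rc v) ∎
  where
  younger : Fin (length ts) → Node (node a ts)
  younger j = child j root

-- The contribution of the elder siblings to `drsw`, common to both of its cases.
chainSum : {t : Tree A} → Node t → ℕ
chainSum v = sum (map lchain (Lc v))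

chainSum-child : (ts : List (Tree A)) (i : Fin (length ts)) (v : Node (lookup ts i)) →
                 chainSum (child {a = a} {ts} i v)
                 ≡ sum (map (leftChain ∘ lookup ts) (below i)) + chainSum v
chainSum-child {a = a} ts i v = begin
  sum (map lchain (map elder (below i) ++ map (child {a = a} {ts} i) (Lc v)))
    ≡⟨ cong sum (map-++ lchain (map elder (below i)) _) ⟩
  sum (map lchain (map elder (below i)) ++ map lchain (map (child {a = a} {ts} i) (Lc v)))
    ≡⟨ sum-++ (map lchain (map elder (below i))) _ ⟩
  sum (map lchain (map elder (below i))) + sum (map lchain (map (child {a = a} {ts} i) (Lc v)))
    ≡⟨ cong₂ (λ xs ys → sum xs + sum ys) (map-∘ (below i)) (map-∘ (Lc v)) ⟨
  sum (map (leftChain ∘ lookup ts) (below i)) + chainSum v ∎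
  where
  elder : Fin (length ts) → Node (node a ts)
  elder j = child j root

lev-toNode : (p : Pos b) → lev (toNode {a = a} p) ≡ suc (lefts p)
lev-toNode here              = refl
lev-toNode (left {a = a′} p) = cong suc (lev-toNode {a = a′} p)
lev-toNode {a = a} (right p) = lev-toNode {a = a} p

lc-toNode : (p : Pos b) → lc (toNode {a = a} p) ≡ rights p
lc-toNode here = refl
lc-toNode {a = a} (left {a = a′} {l} {r} p) = begin
  lc (toNode {b = bin a′ l r} {a} (left p))
    ≡⟨ length-Lc-child {a = a} (φᶠ⁻¹ (bin a′ l r)) zero (toNode {a = a′} p) ⟩
  lc (toNode {a = a′} p)
    ≡⟨ lc-toNode p ⟩
  rights p ∎
lc-toNode {a = a} (right {a = a′} {l} {r} p) = begin
  lc (toNode {b = bin a′ l r} {a} (right p))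
    ≡⟨ length-Lc-child {a = a} (φᶠ⁻¹ (bin a′ l r)) (suc (index p)) (inner p) ⟩
  suc (length (map suc (below (index p)))) + lc (inner p)
    ≡⟨ cong (λ k → suc k + lc (inner p)) (length-map suc (below (index p))) ⟩
  suc (length (below (index p)) + lc (inner p))
    ≡⟨ cong suc (length-Lc-child {a = a} (φᶠ⁻¹ r) (index p) (inner p)) ⟨
  suc (lc (toNode {a = a} p))
    ≡⟨ cong suc (lc-toNode p) ⟩
  suc (rights p) ∎

degree-toNode : (p : Pos b) → degree (toNode {a = a} p) ≡ length (φᶠ⁻¹ (leftOf p))
degree-toNode p = cong (length ∘ children) (subtree-inner p)

-- A new eldest sibling shifts indices but changes nothing to the right of the node. The two younger
-- siblings belong to different trees, so only their subtrees can be compared.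
subtree-closestYounger-suc : (ts : List (Tree A)) (i : Fin (length ts)) (v : Node (lookup ts i)) →
  Maybe.map subtree (closestYounger (child {a = a} {t ∷ ts} (suc i) v))
  ≡ Maybe.map subtree (closestYounger (child {a = a′} {ts} i v))
subtree-closestYounger-suc ts i v with isRoot v | above i | closestYounger v
... | true  | []    | _       = refl
... | true  | _ ∷ _ | _       = refl
... | false | _     | nothing = refl
... | false | _     | just _  = refl

-- The closest younger sibling is the right child of the position, hence the first tree decoded from
-- `rightOf p`. Earlier left steps only wrap it in `child zero`, which keeps its subtree.
subtree-closestYounger : (p : Pos b) →
  Maybe.map subtree (closestYounger (toNode {a = a} p)) ≡ head (φᶠ⁻¹ (rightOf p))
subtree-closestYounger (here {r = empty})     = refl
subtree-closestYounger (here {r = bin _ _ _}) = refl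
subtree-closestYounger (left {a = a} p) =
  trans (sym (Maybeₚ.map-∘ (closestYounger (toNode {a = a} p))))
        (subtree-closestYounger p)
subtree-closestYounger {a = a} (right {r = r} p) =
  trans (subtree-closestYounger-suc {a′ = a} (φᶠ⁻¹ r) (index p) (inner p)) (subtree-closestYounger p)

chainSum-left : (p : Pos l) →
  chainSum (toNode {a = a} (left {a = a′} {r = r} p)) ≡ chainSum (toNode {a = a′} p)
chainSum-left {l = l} {a = a} {a′ = a′} {r = r} p =
  chainSum-child {a = a} (φᶠ⁻¹ (bin a′ l r)) zero (toNode {a = a′} p)

-- A right step passes exactly one further elder sibling, the node named `a′`; the others only have
-- their indices shifted.
chainSum-right : (p : Pos r) →
  chainSum (toNode {a = a} (right {a = a′} {l = l} p))
  ≡ leftChain (node a′ (φᶠ⁻¹ l)) + chainSum (toNode {a = a} p)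
chainSum-right {r = r} {a = a} {a′ = a′} {l = l} p = begin
  chainSum (toNode {a = a} (right {a = a′} {l = l} p))
    ≡⟨ chainSum-child {a = a} siblings (suc (index p)) (inner p) ⟩
  k + sum (map (leftChain ∘ lookup siblings) (map suc (below (index p)))) + chainSum (inner p)
    ≡⟨ cong (λ xs → k + sum xs + chainSum (inner p)) (map-∘ (below (index p))) ⟨
  k + s + chainSum (inner p)
    ≡⟨ +-assoc k s (chainSum (inner p)) ⟩
  k + (s + chainSum (inner p))
    ≡⟨ cong (k +_) (chainSum-child {a = a} (φᶠ⁻¹ r) (index p) (inner p)) ⟨
  k + chainSum (toNode {a = a} p) ∎
  where
  siblings = node a′ (φᶠ⁻¹ l) ∷ φᶠ⁻¹ r
  k  = leftChain (node a′ (φᶠ⁻¹ l))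
  s  = sum (map (leftChain ∘ lookup (φᶠ⁻¹ r)) (below (index p)))

-- Mirroring

-- The left spine of the mirror image is the right spine of `b`, which runs through the siblings.
-- The added parent `a` supplies the edge to the first of them.
leftChain-mirror : (b : Bin A) →
                   leftChain (node a (φᶠ⁻¹ (mirror b))) ≡ length (φᶠ⁻¹ b)
leftChain-mirror empty       = refl
leftChain-mirror (bin _ _ r) = cong suc (leftChain-mirror r)

-- This merges the two cases of `dlsw` and `drsw`: a younger sibling exists after mirroring exactly
-- when the original node has a child, and its left chain is one shorter than the number of
-- children. Hence `nothing` corresponds to 0 and `just k` to `suc k`.
maybe-leftChain-mirror : (b : Bin A) {f g : ℕ → ℕ} {z : ℕ} →
  z ≡ g 0 → (∀ k → f k ≡ g (suc k)) →
  maybe f z (Maybe.map leftChain (head (φᶠ⁻¹ (mirror b)))) ≡ g (length (φᶠ⁻¹ b))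
maybe-leftChain-mirror empty       z≡ f≡ = z≡
maybe-leftChain-mirror (bin _ _ r) {g = g} z≡ f≡ =
  trans (f≡ _) (cong (g ∘ suc) (leftChain-mirror r))

lchain-closestYounger-mirror : (p : Pos b) →
  Maybe.map lchain (closestYounger (toNode {a = a} (mirrorPos p)))
  ≡ Maybe.map leftChain (head (φᶠ⁻¹ (mirror (leftOf p))))
lchain-closestYounger-mirror {a = a} p = begin
  Maybe.map lchain (closestYounger v)
    ≡⟨ Maybeₚ.map-∘ (closestYounger v) ⟩
  Maybe.map leftChain (Maybe.map subtree (closestYounger v))
    ≡⟨ cong (Maybe.map leftChain) (subtree-closestYounger (mirrorPos p)) ⟩
  Maybe.map leftChain (head (φᶠ⁻¹ (rightOf (mirrorPos p))))
    ≡⟨ cong (Maybe.map leftChain ∘ head ∘ φᶠ⁻¹) (rightOf-mirror p) ⟩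
  Maybe.map leftChain (head (φᶠ⁻¹ (mirror (leftOf p)))) ∎
  where v = toNode {a = a} (mirrorPos p)

-- The younger siblings of a node w in T are the non-initial nodes of the left
-- chain of w in the mirrored tree, and the proper ancestors of v below the root
-- of T are the nodes of Lc v in the mirrored tree.
length-Rc-mirror : (p : Pos b) →
  length (Rc (toNode {a = a} p))
  ≡ chainSum (toNode {a = a′} (mirrorPos p)) + lchain (toNode {a = a′} (mirrorPos p))
length-Rc-mirror {a = a} (here {a = c} {l} {r}) = begin
  length (Rc (toNode {a = a} (here {a = c} {l} {r})))
    ≡⟨ length-Rc-child {a = a} (φᶠ⁻¹ (bin c l r)) zero root ⟩
  length (above {suc (length (φᶠ⁻¹ r))} zero) + 0
    ≡⟨ +-identityʳ _ ⟩
  length (above {suc (length (φᶠ⁻¹ r))} zero)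
    ≡⟨ length-above-zero (length (φᶠ⁻¹ r)) ⟩
  length (φᶠ⁻¹ r)
    ≡⟨ leftChain-mirror r ⟨
  leftChain (node c (φᶠ⁻¹ (mirror r))) ∎
length-Rc-mirror {a = a} {a′ = a′} (left {a = c} {l} {r} p) = begin
  length (Rc (toNode {a = a} (left {a = c} {l} {r} p)))
    ≡⟨ length-Rc-child {a = a} (φᶠ⁻¹ (bin c l r)) zero (toNode {a = c} p) ⟩
  length (above {suc (length (φᶠ⁻¹ r))} zero) + length (Rc (toNode {a = c} p))
    ≡⟨ cong₂ _+_ (length-above-zero (length (φᶠ⁻¹ r))) (length-Rc-mirror p) ⟩
  length (φᶠ⁻¹ r) + (chainSum q + lchain q)
    ≡⟨ cong (_+ (chainSum q + lchain q)) (leftChain-mirror r) ⟨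
  k + (chainSum q + lchain q)
    ≡⟨ +-assoc k (chainSum q) (lchain q) ⟨
  k + chainSum q + lchain q
    ≡⟨ cong (_+ lchain q) (chainSum-right {a = a′} (mirrorPos p)) ⟨
  chainSum (toNode {a = a′} (right {a = c} {l = mirror r} (mirrorPos p))) + lchain q ∎
  where
  q = toNode {a = a′} (mirrorPos p)
  k = leftChain (node c (φᶠ⁻¹ (mirror r)))
length-Rc-mirror {a = a} {a′ = a′} (right {a = c} {l} {r} p) = begin
  length (Rc (toNode {a = a} (right {a = c} {l} p)))
    ≡⟨ length-Rc-child {a = a} (φᶠ⁻¹ (bin c l r)) (suc (index p)) (inner p) ⟩
  length (above (suc (index p))) + length (Rc (inner p))
    ≡⟨ cong (_+ length (Rc (inner p))) (length-above-suc (index p)) ⟩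
  length (above (index p)) + length (Rc (inner p))
    ≡⟨ length-Rc-child {a = a} (φᶠ⁻¹ r) (index p) (inner p) ⟨
  length (Rc (toNode {a = a} p))
    ≡⟨ length-Rc-mirror p ⟩
  chainSum q + lchain q
    ≡⟨ cong (_+ lchain q) (chainSum-left {a = a′} (mirrorPos p)) ⟨
  chainSum (toNode {a = a′} (left {a = c} {r = mirror l} (mirrorPos p))) + lchain q ∎
  where q = toNode {a = c} (mirrorPos p)

-- The three statistics of a non-root node under mirroring

lev-mirror : (p : Pos b) → lev (toNode {a = a} p) ≡ dlev (toNode {a = a′} (mirrorPos p))
lev-mirror {a = a} {a′ = a′} p = begin
  lev (toNode {a = a} p)                    ≡⟨ lev-toNode {a = a} p ⟩
  suc (lefts p)                             ≡⟨ cong suc (rights-mirror p) ⟨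
  suc (rights (mirrorPos p))                ≡⟨ cong suc (lc-toNode (mirrorPos p)) ⟨
  suc (lc (toNode {a = a′} (mirrorPos p)))  ≡⟨ +-comm 1 _ ⟩
  lc (toNode {a = a′} (mirrorPos p)) + 1    ∎

lsw-mirror : (p : Pos b) → lsw (toNode {a = a} p) ≡ dlsw (toNode {a = a′} (mirrorPos p))
lsw-mirror {a = a} {a′ = a′} p = begin
  degree (toNode {a = a} p) + lc (toNode {a = a} p)
    ≡⟨ cong₂ _+_ (degree-toNode {a = a} p) (lc-toNode p) ⟩
  length (φᶠ⁻¹ (leftOf p)) + rights p
    -- Since `lev q` is `suc (rights p)`, the default `lev q ∸ 1` is `rights p`, and `k + lev q`
    -- equals `suc k + rights p`.
    ≡⟨ maybe-leftChain-mirror (leftOf p) {g = _+ rights p} (cong (_∸ 1) lev-q)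
         (λ k → trans (cong (k +_) lev-q) (+-suc k (rights p))) ⟨
  maybe (_+ lev q) (lev q ∸ 1) (Maybe.map leftChain (head (φᶠ⁻¹ (mirror (leftOf p)))))
    ≡⟨ cong (maybe (_+ lev q) (lev q ∸ 1)) (lchain-closestYounger-mirror p) ⟨
  maybe (_+ lev q) (lev q ∸ 1) (Maybe.map lchain (closestYounger q))
    ≡⟨ Maybeₚ.maybe-map (_+ lev q) (lev q ∸ 1) lchain (closestYounger q) ⟩
  dlsw q ∎
  where
  q = toNode {a = a′} (mirrorPos p)

  lev-q : lev q ≡ suc (rights p)
  lev-q = trans (lev-toNode {a = a′} (mirrorPos p)) (cong suc (lefts-mirror p))

sum-lchain-++ : {t : Tree A} (v : Node t) (us : List (Node t)) →
                sum (map lchain (Lc v ++ us)) ≡ chainSum v + sum (map lchain us)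
sum-lchain-++ v us =
  trans (cong sum (map-++ lchain (Lc v) us)) (sum-++ (map lchain (Lc v)) _)

-- The younger sibling enters `drsw` only through the length of its left chain, so the case
-- distinction can be moved to a `Maybe ℕ`, where `maybe-leftChain-mirror` applies.
drsw-maybe : {t : Tree A} (v : Node t) →
  drsw v ≡ maybe (λ k → suc (k + (chainSum v + lchain v))) (chainSum v + lchain v)
                 (Maybe.map lchain (closestYounger v))
drsw-maybe v with closestYounger v
... | nothing = trans (sum-lchain-++ v (v ∷ []))
                      (cong (chainSum v +_) (+-identityʳ (lchain v)))
... | just u  = cong suc (trans (sum-lchain-++ v (u ∷ v ∷ []))
  (solve 3 (λ s k m → s :+ (k :+ (m :+ con 0)) := k :+ (s :+ m)) refl
     (chainSum v) (lchain u) (lchain v)))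
  where open +-*-Solver

rsw-mirror : (p : Pos b) → rsw (toNode {a = a} p) ≡ drsw (toNode {a = a′} (mirrorPos p))
rsw-mirror {a = a} {a′ = a′} p = begin
  degree (toNode {a = a} p) + length (Rc (toNode {a = a} p))
    ≡⟨ cong₂ _+_ (degree-toNode {a = a} p) (length-Rc-mirror p) ⟩
  length (φᶠ⁻¹ (leftOf p)) + m
    ≡⟨ maybe-leftChain-mirror (leftOf p) {g = _+ m} refl (λ _ → refl) ⟨
  maybe (λ k → suc (k + m)) m (Maybe.map leftChain (head (φᶠ⁻¹ (mirror (leftOf p)))))
    ≡⟨ cong (maybe (λ k → suc (k + m)) m) (lchain-closestYounger-mirror p) ⟨
  maybe (λ k → suc (k + m)) m (Maybe.map lchain (closestYounger q))
    ≡⟨ drsw-maybe q ⟨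
  drsw q ∎
  where
  q = toNode {a = a′} (mirrorPos p)
  m = chainSum q + lchain q

-- Matching nodes by name, and the theorem

toNode-name≢ : {b : Bin A} → Unique (a ∷ namesᴮ b) → (p : Pos b) →
               name (toNode {a = a} p) ≢ a
toNode-name≢ {a = a} {b = b} u p eq = Unique[x∷xs]⇒x∉xs u
  (subst (_∈ namesᴮ b) (trans (sym (name-toNode {a = a} p)) eq) (posName∈ p))

statistics-mirror : (b : Bin A) →
  Unique (a ∷ namesᴮ b) → Unique (a ∷ namesᴮ (mirror b)) →
  (x : Node (node a (φᶠ⁻¹ b))) (y : Node (node a (φᶠ⁻¹ (mirror b)))) →
  name x ≡ name y →
  (lev x , lsw x , rsw x) ≡ (dlev y , dlsw y , drsw y)
statistics-mirror {a = a} b u u′ x y x≡y with view x | view {b = mirror b} y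
... | atRoot  | atRoot  =
  -- At the root no siblings contribute, and the degree becomes the left chain of the root. The sum
  -- in `drsw` has one entry and ends in `+ 0`, just as `rsw` does; `dlsw` has no such summand.
  cong₂ (λ j k → 0 , j , k) (trans (+-identityʳ _) chain) (cong (_+ 0) chain)
  where
  chain : length (φᶠ⁻¹ b) ≡ leftChain (node a (φᶠ⁻¹ (mirror b)))
  chain = sym (leftChain-mirror b)
... | atRoot  | atPos q = contradiction (sym x≡y) (toNode-name≢ u′ q)
... | atPos p | atRoot  = contradiction x≡y (toNode-name≢ u p)
... | atPos p | atPos q
  -- Mirroring keeps names, so `mirrorPos p` and `q` carry the same name and must coincide.
  with refl ← posName-injective (mirror b) (tail u′) (mirrorPos p) q
                (trans (posName-mirror p)
                  (trans (sym (name-toNode {a = a} p)) (trans x≡y (name-toNode {a = a} q)))) =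
  cong₂ _,_ (lev-mirror {a = a} {a′ = a} p) (cong₂ _,_ (lsw-mirror p) (rsw-mirror p))

names-unique : (T : 𝒫 n) → Unique (names (𝒫.tree T))
names-unique {n} T = Unique-resp-↭ (↭-sym (𝒫.named T)) (allFin⁺ (suc n))

theorem2p11 : (n : ℕ) → n ≥ 1 → (T : 𝒫 n) (v : Fin (suc n)) →
    (lev (T at v) , lsw (T at v) , rsw (T at v))
    ≡ (dlev (φ~ T at v) , dlsw (φ~ T at v) , drsw (φ~ T at v))
theorem2p11 n _ T@(mk𝒫 (node _ ts) refl _ _) v =
  transported (φᶠ ts) (sym (φᶠ⁻¹-φᶠ ts)) (names-unique T) (names-unique (φ~ T))
    (T at v) (φ~ T at v) (trans (name-at T v) (sym (name-at (φ~ T) v)))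
  where
  -- The children of the given root are decoded from a binary tree only up to a propositional
  -- equality, and the type of `x` depends on them. With `ts` generalised, that equality can be
  -- matched with `refl`.
  transported : ∀ {a ts} (b : Bin (Fin (suc n))) → ts ≡ φᶠ⁻¹ b →
    Unique (a ∷ namesF ts) → Unique (a ∷ namesF (φᶠ⁻¹ (mirror b))) →
    (x : Node (node a ts)) (y : Node (node a (φᶠ⁻¹ (mirror b)))) →
    name x ≡ name y →
    (lev x , lsw x , rsw x) ≡ (dlev y , dlsw y , drsw y)
  transported {a} b refl u u′ = statistics-mirror b
    (subst (Unique ∘ (a ∷_)) (namesF-φᶠ⁻¹ b) u)
    (subst (Unique ∘ (a ∷_)) (namesF-φᶠ⁻¹ (mirror b)) u′)
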